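{- Let $\lambda\supseteq\mu$ be partitions and let $T$ be a Dyck tiling of $\lambda\setminus\mu$. The following nine conditions are equivalent: (1) $T$ is cover-inclusive; (2) whenever $\mathfrak a$ and $\mathtt N(\mathfrak a)$ are both nodes of $\lambda\setminus\mu$, we have $\operatorname{dp}(\mathtt N(\mathfrak a))\ge\operatorname{dp}(\mathfrak a)$; (3) whenever $\mathfrak a$ and $\mathtt N(\mathfrak a)$ are both nodes of $\lambda\setminus\mu$, we have $\operatorname{tile}(\mathfrak a)+(1,1)\subseteq\operatorname{tile}(\mathtt N(\mathfrak a))$; (4) whenever $\mathfrak a$ and $\mathtt N(\mathfrak a)$ are nodes of $\lambda\setminus\mu$ and $\mathfrak a$ is attached to $\mathtt{NW}(\mathfrak a)$, the node $\mathtt{NW}(\mathtt N(\mathfrak a))$ lies in $\lambda\setminus\mu$ and $\mathtt N(\mathfrak a)$ is attached to it; (5) whenever $\mathfrak a$ and $\mathtt N(\mathfrak a)$ are nodes of $\lambda\setminus\mu$ and $\mathtt N(\mathfrak a)$ is the end node of its tile, $\mathfrak a$ is the end node of its tile; (6) $T$ is right-cover-inclusive; (7) whenever $\mathfrak a$ and $\mathtt N(\mathfrak a)$ are nodes of $\lambda\setminus\mu$ and $\mathfrak a$ is attached to $\mathtt{NE}(\mathfrak a)$, the node $\mathtt{NE}(\mathtt N(\mathfrak a))$ lies in $\lambda\setminus\mu$ and $\mathtt N(\mathfrak a)$ is attached to it; (8) whenever $\mathfrak a$ and $\mathtt N(\mathfrak a)$ are nodes of $\lambda\setminus\mu$ and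 $\mathtt N(\mathfrak a)$ is the start node of its tile, $\mathfrak a$ is the start node of its tile; (9) $T$ is left-cover-inclusive.
   Context: A partition $\lambda$ is identified with its Young diagram $\{(a,b)\in\mathbb N^2: b\le\lambda_a\}$ ($\mathbb N=\{1,2,\dots\}$); $\lambda\supseteq\mu$ means $\lambda_i\ge\mu_i$ for all $i$, and $\lambda\setminus\mu$ is the set difference of diagrams. Elements of $\mathbb N^2$ are called nodes. The height of $(a,b)$ is $\operatorname{ht}(a,b)=a+b$, and $(a,b)$ lies in column $b-a$; a node is to the left of another if its column index is smaller. Neighbours of a node $\mathfrak n$: $\mathtt{NE}(\mathfrak n)=\mathfrak n+(0,1)$, $\mathtt{SW}(\mathfrak n)=\mathfrak n-(0,1)$, $\mathtt{NW}(\mathfrak n)=\mathfrak n+(1,0)$, $\mathtt{SE}(\mathfrak n)=\mathfrak n-(1,0)$, $\mathtt N(\mathfrak n)=\mathfrak n+(1,1)$, $\mathtt S(\mathfrak n)=\mathfrak n-(1,1)$. A tile is a finite nonempty set $t$ of nodes that can be ordered $\mathfrak n_1,\dots,\mathfrak n_r$ with $\mathfrak n_{i+1}\in\{\mathtt{NE}(\mathfrak n_i),\mathtt{SE}(\mathfrak n_i)\}$; its start $\operatorname{st}(t)$ is its leftmost node and its end $\operatorname{en}(t)$ its rightmost node; $\operatorname{ht}(t)=\max_{\mathfrak n\in t}\operatorname{ht}(\mathfrak n)$; $t$ is a Dyck tile if $\operatorname{ht}(\operatorname{st}t)=\operatorname{ht}(\operatorname{en}t)=\operatorname{ht}(t)$.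 The depth of $\mathfrak n\in t$ is $\operatorname{dp}(\mathfrak n)=\operatorname{ht}(t)-\operatorname{ht}(\mathfrak n)$. A Dyck tiling of $\lambda\setminus\mu$ is a partition of $\lambda\setminus\mu$ into Dyck tiles; $\operatorname{tile}(\mathfrak n)$ is the tile containing $\mathfrak n$, and $\mathfrak n$ is attached to a neighbour if they lie in the same tile. A Dyck tiling is left-cover-inclusive if whenever $\mathfrak a,\mathtt N(\mathfrak a)\in\lambda\setminus\mu$, $\operatorname{st}(\operatorname{tile}(\mathtt N(\mathfrak a)))$ lies weakly to the left of $\operatorname{st}(\operatorname{tile}(\mathfrak a))$; right-cover-inclusive if whenever $\mathfrak a,\mathtt N(\mathfrak a)\in\lambda\setminus\mu$, $\operatorname{en}(\operatorname{tile}(\mathtt N(\mathfrak a)))$ lies weakly to the right of $\operatorname{en}(\operatorname{tile}(\mathfrak a))$; cover-inclusive if both. -}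

module Defs where

open import Data.Fin.Base using (Fin)
open import Data.Integer.Base as ℤ using (ℤ)
import Data.Integer.Properties as ℤ
open import Data.List.Base using (List; map)
import Data.List.Extrema
import Data.List.Extrema.Nat as ExtremaNat
import Data.List.Membership.Propositional as List
open import Data.List.NonEmpty.Base as List⁺ using (List⁺; _∷_; toList)
open import Data.List.Relation.Unary.Linked using (Linked)
open import Data.Nat.Base using (ℕ; suc; _+_; _∸_; _≤_; _≥_)
open import Data.Product.Base using (_×_; ∃-syntax; proj₁)
open import Data.Sum.Base using (_⊎_)
open import Data.Vec.Base using (Vec; lookup)
open import Level using (0ℓ)
open import Relation.Binary.PropositionalEquality.Core using (_≡_)
open import Relation.Unary using (Pred; _∈_; _⊆_; _∖_)

private
  module Extremaℤ = Data.List.Extrema ℤ.≤-totalOrder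

-- Coordinates are stored zero-based: node i j is the node (i + 1, j + 1),
-- so that every value of the type is an element of {1,2,…}².
record Node : Set where
  constructor node
  field
    i j : ℕ

  row col : ℕ
  row = suc i
  col = suc j

open Node public using (row; col)

ht : Node → ℕ
ht n = row n + col n

column : Node → ℤ
column n = ℤ.+ col n ℤ.- ℤ.+ row n

NE NW N : Node → Node
NE (node i j) = node i (suc j)
NW (node i j) = node (suc i) j
N  (node i j) = node (suc i) (suc j)

-- SE is only partially defined on nodes, so it is given by its graph:
-- m = n - (1,0) exactly when m + (1,0) = n.
_isSEof_ : Node → Node → Set
m isSEof n = NW m ≡ n

-- part i is the (i + 1)-st part.
record Partition : Set where
  field
    part       : ℕ → ℕ
    decreasing : ∀ i → part (suc i) ≤ part i
    finite     : ∃[ k ] (∀ i → k ≤ i → part i ≡ 0)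

open Partition public using (part)

_⊇_ : Partition → Partition → Set
lam ⊇ mu = ∀ i → part lam i ≥ part mu i

diagram : Partition → Pred Node 0ℓ
diagram lam n = col n ≤ part lam (Node.i n)

skew : Partition → Partition → Pred Node 0ℓ
skew lam mu = diagram lam ∖ diagram mu

Step : Node → Node → Set
Step n m = m ≡ NE n ⊎ m isSEof n

-- A tile is represented by the list of its nodes in the order n₁,…,nᵣ. Each
-- step raises the column by exactly 1, so this ordering is determined by the
-- underlying set and has no repetitions: distinct tiles are distinct lists.
IsTile : Pred (List⁺ Node) 0ℓ
IsTile t = Linked Step (toList t)

nodes : List⁺ Node → Pred Node 0ℓ
nodes t n = n List.∈ toList t

st : List⁺ Node → Node
st (n ∷ ns) = Extremaℤ.argmin column n ns

en : List⁺ Node → Node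
en (n ∷ ns) = Extremaℤ.argmax column n ns

tileHt : List⁺ Node → ℕ
tileHt (n ∷ ns) = ExtremaNat.max (ht n) (map ht ns)

IsDyckTile : Pred (List⁺ Node) 0ℓ
IsDyckTile t = IsTile t × ht (st t) ≡ ht (en t) × ht (en t) ≡ tileHt t

-- The set of tiles is finite because λ∖μ is; repetitions in the list
-- are immaterial.
record DyckTiling (lam mu : Partition) : Set where
  field
    tiles    : List (List⁺ Node)
    dyck     : ∀ {t} → t List.∈ tiles → IsDyckTile t
    inside   : ∀ {t} → t List.∈ tiles → nodes t ⊆ skew lam mu
    covers   : ∀ n → n ∈ skew lam mu → ∃[ t ] (t List.∈ tiles × n ∈ nodes t)
    disjoint : ∀ {t u n} → t List.∈ tiles → u List.∈ tiles →
               n ∈ nodes t → n ∈ nodes u → t ≡ u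

module _ {lam mu : Partition} (T : DyckTiling lam mu) where

  open DyckTiling T

  -- Independent of the membership proof, by disjointness.
  tile : ∀ n → n ∈ skew lam mu → List⁺ Node
  tile n p = proj₁ (covers n p)

  -- No truncation occurs in ∸, since n lies in tile n p.
  dp : ∀ n → n ∈ skew lam mu → ℕ
  dp n p = tileHt (tile n p) ∸ ht n

  Attached : Node → Node → Set
  Attached n m = ∃[ t ] (t List.∈ tiles × n ∈ nodes t × m ∈ nodes t)

  IsStart IsEnd : ∀ n → n ∈ skew lam mu → Set
  IsStart n p = st (tile n p) ≡ n
  IsEnd   n p = en (tile n p) ≡ n

  LeftCoverInclusive : Set
  LeftCoverInclusive = ∀ a (p : a ∈ skew lam mu) (q : N a ∈ skew lam mu) →
    column (st (tile (N a) q)) ℤ.≤ column (st (tile a p))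

  RightCoverInclusive : Set
  RightCoverInclusive = ∀ a (p : a ∈ skew lam mu) (q : N a ∈ skew lam mu) →
    column (en (tile (N a) q)) ℤ.≥ column (en (tile a p))

  CoverInclusive : Set
  CoverInclusive = LeftCoverInclusive × RightCoverInclusive

  DepthCondition : Set
  DepthCondition = ∀ a (p : a ∈ skew lam mu) (q : N a ∈ skew lam mu) →
    dp (N a) q ≥ dp a p

  TranslateCondition : Set
  TranslateCondition = ∀ a (p : a ∈ skew lam mu) (q : N a ∈ skew lam mu) →
    nodes (List⁺.map N (tile a p)) ⊆ nodes (tile (N a) q)

  NWCondition : Set
  NWCondition = ∀ a → a ∈ skew lam mu → N a ∈ skew lam mu →
    Attached a (NW a) → NW (N a) ∈ skew lam mu × Attached (N a) (NW (N a))

  NECondition : Set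
  NECondition = ∀ a → a ∈ skew lam mu → N a ∈ skew lam mu →
    Attached a (NE a) → NE (N a) ∈ skew lam mu × Attached (N a) (NE (N a))

  EndCondition : Set
  EndCondition = ∀ a (p : a ∈ skew lam mu) (q : N a ∈ skew lam mu) →
    IsEnd (N a) q → IsEnd a p

  StartCondition : Set
  StartCondition = ∀ a (p : a ∈ skew lam mu) (q : N a ∈ skew lam mu) →
    IsStart (N a) q → IsStart a p

AllEquivalent : ∀ {n} → Vec Set n → Set
AllEquivalent {n} Ps = ∀ (k l : Fin n) → lookup Ps k → lookup Ps l

{-# OPTIONS --safe #-}

-- For a side s write up s a for NW a (left) or NE a (right). If a is
-- attached to up s a then N a is attached to up s (N a) unless N a is the
-- s-most node of its tile: the only other possible neighbour on that side is
-- up s a, which lies in the tile of a. So the start, end and depth conditions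
-- each give the NW or NE condition.
--
-- The NE condition implies the NW condition: let y be attached to NW y, and
-- follow the tile of y rightwards to its end e. By induction on the length of
-- this path, N carries it into the tile of N y: NE steps are lifted by
-- hypothesis, SE steps by the NW condition at a node closer to e. As e has
-- maximal height, it is higher than y, so N e is higher than N y in the same
-- Dyck tile, and N y is not the start of it. Together the two conditions lift
-- every step of a tile, which gives tile(a) + (1,1) ⊆ tile(N a), and all the
-- other conditions follow from this.
module Submission where

open import Defs
open import Data.Empty using (⊥-elim)
open import Data.Fin.Patterns
import Data.Integer.Base as ℤ
import Data.Integer.Properties as ℤ
open import Data.List.Base using (_∷_; map)
import Data.List.Extrema
import Data.List.Extrema.Nat as ExtremaNat
open import Data.List.Membership.Propositional using () renaming (_∈_ to _∈ˡ_)
open import Data.List.Membership.Propositional.Properties using (∈-map⁺; ∈-map⁻)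
open import Data.List.NonEmpty.Base using (List⁺; _∷_)
import Data.List.Relation.Unary.All as All
open import Data.List.Relation.Unary.Any using (here; there)
open import Data.List.Relation.Unary.Linked using (Linked; _∷_)
open import Data.Nat.Base using (suc; _+_; _∸_; _≤_; _<_; z<s)
open import Data.Nat.Properties
open import Data.Product.Base using (_×_; _,_; proj₁; proj₂)
open import Data.Sum.Base as Sum using (_⊎_; inj₁; inj₂)
open import Data.Vec.Base using (lookup; _∷_; [])
open import Level using (0ℓ)
open import Relation.Binary.Construct.Closure.ReflexiveTransitive using (Star; ε; _◅_; reverse)
open import Relation.Binary.PropositionalEquality
open import Relation.Nullary.Negation using (¬_)
open import Relation.Unary using (Pred; _∈_)

private
  module Extremaℤ = Data.List.Extrema ℤ.≤-totalOrder

-- Sides, neighbours and the column order.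

data Side : Set where
  left right : Side

opposite : Side → Side
opposite left  = right
opposite right = left

up : Side → Node → Node
up left  = NW
up right = NE

up-opposite : ∀ s a → up s (up (opposite s) a) ≡ N a
up-opposite left  _ = refl
up-opposite right _ = refl

up-N : ∀ s a → up s (N a) ≡ N (up s a)
up-N left  _ = refl
up-N right _ = refl

opposite-up : ∀ s a → up (opposite s) (up s a) ≡ N a
opposite-up left  _ = refl
opposite-up right _ = refl

up-injective : ∀ s {a b} → up s a ≡ up s b → a ≡ b
up-injective left  refl = refl
up-injective right refl = refl

ht-up : ∀ s a → ht (up s a) ≡ suc (ht a)
ht-up left  a = refl
ht-up right a = +-suc (row a) (col a)

ht-N : ∀ a → ht (N a) ≡ 2 + ht a
ht-N a = cong suc (+-suc (row a) (col a))

N-≢ : ∀ {a} → ¬ N a ≡ a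
N-≢ {a} Na≡a = <⇒≢ (m<n+m (ht a) {2} z<s) (trans (sym (cong ht Na≡a)) (ht-N a))

column-N : ∀ a → column (N a) ≡ column a
column-N (node i j) = ℤ.[1+m]⊖[1+n]≡m⊖n (suc j) (suc i)

-- Oriented so that the larger node lies further towards `s`; the `s`-most node is then a maximum on
-- either side.
_≤[_]_ _<[_]_ : Node → Side → Node → Set
x ≤[ left  ] y = column y ℤ.≤ column x
x ≤[ right ] y = column x ℤ.≤ column y
x <[ left  ] y = column y ℤ.< column x
x <[ right ] y = column x ℤ.< column y

≤[]-antisym : ∀ s {x y} → x ≤[ s ] y → y ≤[ s ] x → column x ≡ column y
≤[]-antisym left  p q = ℤ.≤-antisym q p
≤[]-antisym right p q = ℤ.≤-antisym p q

<[]⇒≱[] : ∀ s {x y} → x <[ s ] y → ¬ y ≤[ s ] x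
<[]⇒≱[] left  = ℤ.<⇒≱
<[]⇒≱[] right = ℤ.<⇒≱

<[]-≤[]-trans : ∀ s {x y z} → x <[ s ] y → y ≤[ s ] z → x <[ s ] z
<[]-≤[]-trans left  p q = ℤ.≤-<-trans q p
<[]-≤[]-trans right p q = ℤ.<-≤-trans p q

<[]⇒≤[] : ∀ s {x y} → x <[ s ] y → x ≤[ s ] y
<[]⇒≤[] left  = ℤ.<⇒≤
<[]⇒≤[] right = ℤ.<⇒≤

≤[]-reflexive : ∀ s {x y} → column x ≡ column y → x ≤[ s ] y
≤[]-reflexive left  e = ℤ.≤-reflexive (sym e)
≤[]-reflexive right e = ℤ.≤-reflexive e

≤[]-respˡ : ∀ s {x y z} → column x ≡ column y → x ≤[ s ] z → y ≤[ s ] z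
≤[]-respˡ left  {z = z} e = subst (column z ℤ.≤_) e
≤[]-respˡ right {z = z} e = subst (ℤ._≤ column z) e

≤[]-respʳ : ∀ s {x y z} → column x ≡ column y → z ≤[ s ] x → z ≤[ s ] y
≤[]-respʳ left  {z = z} e = subst (ℤ._≤ column z) e
≤[]-respʳ right {z = z} e = subst (column z ℤ.≤_) e

column-<-NE : ∀ a → column a ℤ.< column (NE a)
column-<-NE a = ℤ.⊖-monoˡ-< (row a) (n<1+n (col a))

column-NW-< : ∀ a → column (NW a) ℤ.< column a
column-NW-< a = ℤ.⊖-monoʳ->-< (col a) (n<1+n (row a))

<[]-up : ∀ s a → a <[ s ] up s a
<[]-up left  = column-NW-<
<[]-up right = column-<-NE

-- Step of Defs is Move right.
Move : Side → Node → Node → Set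
Move s a b = b ≡ up s a ⊎ up (opposite s) b ≡ a

Move-<[] : ∀ s {a b} → Move s a b → a <[ s ] b
Move-<[] s     (inj₁ refl) = <[]-up s _
Move-<[] left  {b = b} (inj₂ refl) = column-<-NE b
Move-<[] right {b = b} (inj₂ refl) = column-NW-< b

-- Paths inside a tile.

MoveIn : Pred Node 0ℓ → Side → Node → Node → Set
MoveIn P s a b = Move s a b × P a × P b

Path : Pred Node 0ℓ → Side → Node → Node → Set
Path P s = Star (MoveIn P s)

-- The clauses agree; splitting on `s` makes `opposite (opposite s)` reduce.
Path-reverse : ∀ {P a b} s → Path P s a b → Path P (opposite s) b a
Path-reverse left  = reverse λ where
  (inj₁ e , p , q) → inj₂ (sym e) , q , p
  (inj₂ e , p , q) → inj₁ (sym e) , q , p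
Path-reverse right = reverse λ where
  (inj₁ e , p , q) → inj₂ (sym e) , q , p
  (inj₂ e , p , q) → inj₁ (sym e) , q , p

Path-≤[] : ∀ {P a b} s → Path P s a b → a ≤[ s ] b
Path-≤[] s ε = ≤[]-reflexive s refl
Path-≤[] s ((m , _) ◅ p) = <[]⇒≤[] s (<[]-≤[]-trans s (Move-<[] s m) (Path-≤[] s p))

Path-cyclic⇒≡ : ∀ {P a b} s → Path P s a b → b ≤[ s ] a → a ≡ b
Path-cyclic⇒≡ s ε _ = refl
Path-cyclic⇒≡ s ((m , _) ◅ p) b≤a =
  ⊥-elim (<[]⇒≱[] s (<[]-≤[]-trans s (Move-<[] s m) (Path-≤[] s p)) b≤a)

module _ {P : Pred Node 0ℓ} where

  path-from-head : ∀ {x xs b} → Linked Step (x ∷ xs) →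
    (∀ {n} → n ∈ˡ x ∷ xs → P n) → b ∈ˡ x ∷ xs → Path P right x b
  path-from-head _ _ (here refl) = ε
  path-from-head (m ∷ l) f (there b∈) =
    (m , f (here refl) , f (there (here refl))) ◅ path-from-head l (λ n∈ → f (there n∈)) b∈

  path-between : ∀ {xs a b} → Linked Step xs → (∀ {n} → n ∈ˡ xs → P n) →
    a ∈ˡ xs → b ∈ˡ xs → Path P right a b ⊎ Path P right b a
  path-between l f (here refl) b∈ = inj₁ (path-from-head l f b∈)
  path-between l f a∈ (here refl) = inj₂ (path-from-head l f a∈)
  path-between (_ ∷ l) f (there a∈) (there b∈) =
    path-between l (λ n∈ → f (there n∈)) a∈ b∈

tile-path : ∀ s {t a b} → IsTile t → a ∈ nodes t → b ∈ nodes t →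
  Path (nodes t) s a b ⊎ Path (nodes t) (opposite s) a b
tile-path right l a∈ b∈ = Sum.map₂ (Path-reverse right) (path-between l (λ n∈ → n∈) a∈ b∈)
tile-path left  l a∈ b∈ = Sum.swap (tile-path right l a∈ b∈)

-- A path joins the two nodes one way or the other, and each of its moves changes the column
-- strictly in one direction, so it is empty.
column-injective : ∀ {t a b} → IsTile t → a ∈ nodes t → b ∈ nodes t →
  column a ≡ column b → a ≡ b
column-injective {a = a} {b} l a∈ b∈ e with tile-path right l a∈ b∈
... | inj₁ p = Path-cyclic⇒≡ right p (≤[]-reflexive right {b} {a} (sym e))
... | inj₂ p = Path-cyclic⇒≡ left  p (≤[]-reflexive left  {b} {a} (sym e))

-- Start and end of a tile.

tip : Side → List⁺ Node → Node
tip left  = st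
tip right = en

sel⇒∈ : ∀ {x y : Node} {xs} → x ≡ y ⊎ x ∈ˡ xs → x ∈ˡ y ∷ xs
sel⇒∈ = Sum.[ here , there ]

tip-∈ : ∀ s t → tip s t ∈ nodes t
tip-∈ left  (n ∷ ns) = sel⇒∈ (Extremaℤ.argmin-sel column n ns)
tip-∈ right (n ∷ ns) = sel⇒∈ (Extremaℤ.argmax-sel column n ns)

≤[]-tip : ∀ s t {x} → x ∈ nodes t → x ≤[ s ] tip s t
≤[]-tip left  (n ∷ ns) (here refl) = Extremaℤ.f[argmin]≤f[⊤] {f = column} n ns
≤[]-tip left  (n ∷ ns) (there x∈)  = All.lookup (Extremaℤ.f[argmin]≤f[xs] {f = column} n ns) x∈
≤[]-tip right (n ∷ ns) (here refl) = Extremaℤ.f[⊥]≤f[argmax] {f = column} n ns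
≤[]-tip right (n ∷ ns) (there x∈)  = All.lookup (Extremaℤ.f[xs]≤f[argmax] {f = column} n ns) x∈

ht≤tileHt : ∀ t {x} → x ∈ nodes t → ht x ≤ tileHt t
ht≤tileHt (n ∷ ns) (here refl) = ExtremaNat.⊥≤max (ht n) (map ht ns)
ht≤tileHt (n ∷ ns) (there x∈)  = All.lookup (ExtremaNat.xs≤max (ht n) (map ht ns)) (∈-map⁺ ht x∈)

ht-tip : ∀ s {t} → IsDyckTile t → ht (tip s t) ≡ tileHt t
ht-tip left  (_ , st≡en , en≡) = trans st≡en en≡
ht-tip right (_ , _ , en≡)     = en≡

path-to-tip : ∀ s {t a} → IsTile t → a ∈ nodes t → Path (nodes t) s a (tip s t)
path-to-tip s {t} l a∈ with tile-path s l a∈ (tip-∈ s t)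
... | inj₁ p = p
-- A path to the `s`-tip leading away from `s` forces equal columns, so `a` is the tip.
... | inj₂ p = subst (Path (nodes t) s _) a≡tip ε
  where
  a≡tip = column-injective l a∈ (tip-∈ s t)
    (≤[]-antisym s (≤[]-tip s t a∈) (opposite-≤[] s (Path-≤[] (opposite s) p)))
    where
    opposite-≤[] : ∀ s {x y} → x ≤[ opposite s ] y → y ≤[ s ] x
    opposite-≤[] left  q = q
    opposite-≤[] right q = q

-- Diagrams are closed downwards: membership in `lam` descends from `N a`, absence from `mu` ascends
-- from `a`.
skew-up : ∀ lam mu s a → a ∈ skew lam mu → N a ∈ skew lam mu → up s a ∈ skew lam mu
skew-up lam mu left  (node i j) (_ , a∉mu) (Na∈lam , _) =
  <⇒≤ Na∈lam , λ h → a∉mu (≤-trans h (Partition.decreasing mu i))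
skew-up lam mu right (node i j) (_ , a∉mu) (Na∈lam , _) =
  ≤-trans Na∈lam (Partition.decreasing lam i) , λ h → a∉mu (<⇒≤ h)

-- Attachment in a Dyck tiling.

module _ {lam mu : Partition} (T : DyckTiling lam mu) where

  open DyckTiling T

  private
    S : Pred Node 0ℓ
    S = skew lam mu

  tile-∈tiles : ∀ {n} (p : n ∈ S) → tile T n p ∈ˡ tiles
  tile-∈tiles p = proj₁ (proj₂ (covers _ p))

  ∈-tile : ∀ {n} (p : n ∈ S) → n ∈ nodes (tile T n p)
  ∈-tile p = proj₂ (proj₂ (covers _ p))

  tile-dyck : ∀ {n} (p : n ∈ S) → IsDyckTile (tile T n p)
  tile-dyck p = dyck (tile-∈tiles p)

  Attached-refl : ∀ {a} → a ∈ S → Attached T a a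
  Attached-refl p = _ , tile-∈tiles p , ∈-tile p , ∈-tile p

  Attached-sym : ∀ {a b} → Attached T a b → Attached T b a
  Attached-sym (t , t∈ , a∈ , b∈) = t , t∈ , b∈ , a∈

  Attached⇒∈nodes : ∀ {t a b} → t ∈ˡ tiles → a ∈ nodes t → Attached T a b → b ∈ nodes t
  Attached⇒∈nodes t∈ a∈ (u , u∈ , a∈u , b∈u) with refl ← disjoint u∈ t∈ a∈u a∈ = b∈u

  Attached-trans : ∀ {a b c} → Attached T a b → Attached T b c → Attached T a c
  Attached-trans (t , t∈ , a∈ , b∈) b~c = t , t∈ , a∈ , Attached⇒∈nodes t∈ b∈ b~c

  Attached⇒∈ : ∀ {a b} → Attached T a b → b ∈ S
  Attached⇒∈ (t , t∈ , _ , b∈) = inside t∈ b∈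

  Attached⇒∈tile : ∀ {a b} (p : a ∈ S) → Attached T a b → b ∈ nodes (tile T a p)
  Attached⇒∈tile p = Attached⇒∈nodes (tile-∈tiles p) (∈-tile p)

  N-not-attached : ∀ {a} → ¬ Attached T a (N a)
  N-not-attached {a} (t , t∈ , a∈ , Na∈) =
    N-≢ (column-injective (proj₁ (dyck t∈)) Na∈ a∈ (column-N a))

  -- One-sided conditions and the passage to `UpCondition`.

  IsTip : Side → ∀ n → n ∈ S → Set
  IsTip s n p = tip s (tile T n p) ≡ n

  -- At `left` and `right` these unfold to the six one-sided conditions of the theorem, so each pair
  -- is treated once.
  CoverInclusiveAt TipCondition UpCondition : Side → Set
  CoverInclusiveAt s = ∀ a (p : a ∈ S) (q : N a ∈ S) →
    tip s (tile T a p) ≤[ s ] tip s (tile T (N a) q)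
  TipCondition s = ∀ a (p : a ∈ S) (q : N a ∈ S) → IsTip s (N a) q → IsTip s a p
  UpCondition s = ∀ a → a ∈ S → N a ∈ S →
    Attached T a (up s a) → up s (N a) ∈ S × Attached T (N a) (up s (N a))

  not-tip⇒up : ∀ s {a} (q : N a ∈ S) → Attached T a (up s a) →
    ¬ IsTip s (N a) q → up s (N a) ∈ S × Attached T (N a) (up s (N a))
  not-tip⇒up s {a} q a~ua ¬tip =
    neighbour (path-to-tip s (proj₁ (tile-dyck q)) (∈-tile q)) refl
    where
    -- The endpoint is generalised to `e` so that the path can be matched against `ε`.
    neighbour : ∀ {e} → Path (nodes (tile T (N a) q)) s (N a) e →
      tip s (tile T (N a) q) ≡ e → up s (N a) ∈ S × Attached T (N a) (up s (N a))
    neighbour ε tip≡ = ⊥-elim (¬tip tip≡)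
    neighbour ((inj₁ refl , Na∈ , b∈) ◅ _) _ =
      inside (tile-∈tiles q) b∈ , _ , tile-∈tiles q , Na∈ , b∈
    -- A first move downwards ends at `up s a`, which would attach `a` to `N a` in its own column.
    neighbour ((inj₂ e , Na∈ , b∈) ◅ _) _
      with refl ← up-injective (opposite s) (trans e (sym (opposite-up s a))) =
      ⊥-elim (N-not-attached (Attached-trans a~ua (_ , tile-∈tiles q , b∈ , Na∈)))

  -- Were `N a` a tip, `a` would be one too, but `up s a` lies beyond `a` in the same tile.
  tip⇒up : ∀ s → TipCondition s → UpCondition s
  tip⇒up s tipC a p q a~ua = not-tip⇒up s q a~ua λ Na-tip →
    <[]⇒≱[] s (<[]-up s a)
      (subst (up s a ≤[ s ]_) (tipC a p q Na-tip)
        (≤[]-tip s (tile T a p) (Attached⇒∈tile p a~ua)))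

  tip⇒ht : ∀ s {n} (p : n ∈ S) → IsTip s n p → tileHt (tile T n p) ≡ ht n
  tip⇒ht s p n-tip = trans (sym (ht-tip s (tile-dyck p))) (cong ht n-tip)

  -- Both tips of a Dyck tile have depth 0. Were `N a` a tip, `a` would have depth 0 as well, but
  -- `up s a` is higher in its tile.
  depth⇒up : ∀ s → DepthCondition T → UpCondition s
  depth⇒up s depth a p q a~ua = not-tip⇒up s q a~ua λ Na-tip →
    <⇒≱ (≤-trans (≤-reflexive (sym (ht-up s a)))
                 (ht≤tileHt (tile T a p) (Attached⇒∈tile p a~ua)))
        (m∸n≡0⇒m≤n (n≤0⇒n≡0 (≤-trans (depth a p q)
          (≤-reflexive (m≤n⇒m∸n≡0 (≤-reflexive (tip⇒ht s q Na-tip)))))))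

  -- Lifting moves and paths by `N`.

  lift-move : ∀ s {t a b} → t ∈ˡ tiles → MoveIn (nodes t) s a b → N a ∈ S →
    UpCondition s →
    (N b ∈ S → Attached T b (up (opposite s) b) → Attached T (N b) (up (opposite s) (N b))) →
    Attached T (N a) (N b)
  lift-move s {a = a} t∈ (inj₁ refl , a∈ , b∈) Na∈S upC _ =
    subst (Attached T (N a)) (up-N s a)
      (proj₂ (upC a (inside t∈ a∈) Na∈S (_ , t∈ , a∈ , b∈)))
  lift-move s {b = b} t∈ (inj₂ refl , a∈ , b∈) Na∈S _ oppC =
    Attached-sym (subst (Attached T (N b)) (up-N (opposite s) b)
      (oppC Nb∈S (_ , t∈ , b∈ , a∈)))
    where
    Nb∈S : N b ∈ S
    -- Here `a` is `up (opposite s) b`, so `N b` is `up s a`, squeezed between `a` and `N a`.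
    Nb∈S = subst S (up-opposite s b) (skew-up lam mu s (up (opposite s) b) (inside t∈ a∈) Na∈S)

  module _ (s : Side) (upC : UpCondition s) {t : List⁺ Node} (t∈ : t ∈ˡ tiles) where

    -- Mutual recursion on the path: lifting a first move from `a` to `b` may need the opposite
    -- condition at `b`, which `opposite-at` derives by lifting the remaining path from `b`. Only
    -- the maximal height of `e` is recorded, so that `e` stays a variable.
    lift-path-to-tip : ∀ {a e} → Path (nodes t) s a e → ht e ≡ tileHt t →
      N a ∈ S → Attached T (N a) (N e)
    opposite-at : ∀ {a e} → Path (nodes t) s a e → ht e ≡ tileHt t → a ∈ nodes t →
      N a ∈ S → Attached T a (up (opposite s) a) →
      up (opposite s) (N a) ∈ S × Attached T (N a) (up (opposite s) (N a))

    lift-path-to-tip ε _ Na∈S = Attached-refl Na∈S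
    lift-path-to-tip (m ◅ path) top Na∈S =
      Attached-trans Na~Nb (lift-path-to-tip path top (Attached⇒∈ Na~Nb))
      where
      Na~Nb = lift-move s t∈ m Na∈S upC
        λ Nb∈S b~ → proj₂ (opposite-at path top (proj₂ (proj₂ m)) Nb∈S b~)

    opposite-at {a} {e} path top a∈ Na∈S a~ =
      -- As a tip, `N a` would have maximal height in its tile, which also contains the higher node
      -- `N e`.
      not-tip⇒up (opposite s) Na∈S a~ λ Na-tip →
        <⇒≱ a<e (+-cancelˡ-≤ 2 _ _ (begin
          2 + ht e                   ≡⟨ ht-N e ⟨
          ht (N e)                   ≤⟨ ht≤tileHt (tile T (N a) Na∈S) (Attached⇒∈tile Na∈S Na~Ne) ⟩
          tileHt (tile T (N a) Na∈S) ≡⟨ tip⇒ht (opposite s) Na∈S Na-tip ⟩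
          ht (N a)                   ≡⟨ ht-N a ⟩
          2 + ht a                   ∎))
      where
      open ≤-Reasoning
      Na~Ne = lift-path-to-tip path top Na∈S
      a<e : ht a < ht e
      a<e = begin
        suc (ht a)              ≡⟨ ht-up (opposite s) a ⟨
        ht (up (opposite s) a)  ≤⟨ ht≤tileHt t (Attached⇒∈nodes t∈ a∈ a~) ⟩
        tileHt t                ≡⟨ top ⟨
        ht e                    ∎

  up⇒opposite : ∀ s → UpCondition s → UpCondition (opposite s)
  up⇒opposite s upC a p q =
    opposite-at s upC (tile-∈tiles p) (path-to-tip s (proj₁ (tile-dyck p)) (∈-tile p))
      (ht-tip s (tile-dyck p)) (∈-tile p) q

  -- Upward moves are lifted by `upC` at their source, downward ones by `oppC` at their target.
  lift-path : ∀ s → UpCondition s → UpCondition (opposite s) → ∀ {t a b} → t ∈ˡ tiles →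
    Path (nodes t) s a b → N a ∈ S → Attached T (N a) (N b)
  lift-path s upC oppC t∈ ε Na∈S = Attached-refl Na∈S
  lift-path s upC oppC t∈ (m ◅ path) Na∈S =
    Attached-trans Na~Nb (lift-path s upC oppC t∈ path (Attached⇒∈ Na~Nb))
    where
    Na~Nb = lift-move s t∈ m Na∈S upC
      λ Nb∈S b~ → proj₂ (oppC _ (inside t∈ (proj₂ (proj₂ m))) Nb∈S b~)

  -- The translate condition and its consequences.

  ups⇒translate : UpCondition left → UpCondition right → TranslateCondition T
  ups⇒translate upL upR a p q m∈ with ∈-map⁻ N m∈
  ... | b , b∈ , refl with tile-path right (proj₁ (tile-dyck p)) (∈-tile p) b∈
  ... | inj₁ path = Attached⇒∈tile q (lift-path right upR upL (tile-∈tiles p) path q)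
  ... | inj₂ path = Attached⇒∈tile q (lift-path left  upL upR (tile-∈tiles p) path q)

  up⇒translate : ∀ s → UpCondition s → TranslateCondition T
  up⇒translate left  upC = ups⇒translate upC (up⇒opposite left upC)
  up⇒translate right upC = ups⇒translate (up⇒opposite right upC) upC

  -- If `N a` is a tip, the tip of the tile of `a` cannot pass the column of `N a`, which is that of
  -- `a`.
  coverInclusive⇒tip : ∀ s → CoverInclusiveAt s → TipCondition s
  coverInclusive⇒tip s cover a p q Na-tip = column-injective (proj₁ (tile-dyck p))
    (tip-∈ s (tile T a p)) (∈-tile p)
    (≤[]-antisym s
      (≤[]-respʳ s (column-N a) (subst (_ ≤[ s ]_) Na-tip (cover a p q)))
      (≤[]-tip s (tile T a p) (∈-tile p)))

  module _ (translate : TranslateCondition T) where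

    N-∈-tile : ∀ {a b} (p : a ∈ S) (q : N a ∈ S) →
      b ∈ nodes (tile T a p) → N b ∈ nodes (tile T (N a) q)
    N-∈-tile p q b∈ = translate _ p q (∈-map⁺ N b∈)

    -- `N` preserves columns and carries the tip of the lower tile into the upper one.
    translate⇒coverInclusive : ∀ s → CoverInclusiveAt s
    translate⇒coverInclusive s a p q = ≤[]-respˡ s (column-N (tip s (tile T a p)))
      (≤[]-tip s (tile T (N a) q) (N-∈-tile p q (tip-∈ s (tile T a p))))

    translate⇒depth : DepthCondition T
    translate⇒depth a p q = begin
      -- `N` raises `a` and the highest node `en t` both by 2, and the two successors on each side
      -- of `∸` cancel by computation.
      tileHt t ∸ ht a              ≡⟨ cong₂ _∸_ (cong (2 +_) (ht-tip right (tile-dyck p))) (ht-N a) ⟨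
      2 + ht (en t) ∸ ht (N a)     ≡⟨ cong (_∸ ht (N a)) (ht-N (en t)) ⟨
      ht (N (en t)) ∸ ht (N a)     ≤⟨ ∸-monoˡ-≤ (ht (N a)) (ht≤tileHt u (N-∈-tile p q (tip-∈ right t))) ⟩
      tileHt u ∸ ht (N a)          ∎
      where
      open ≤-Reasoning
      t u : List⁺ Node
      t = tile T a p
      u = tile T (N a) q

theorem3p1 : (lam mu : Partition) → lam ⊇ mu → (T : DyckTiling lam mu) →
    AllEquivalent
    ( CoverInclusive T
    ∷ DepthCondition T
    ∷ TranslateCondition T
    ∷ NWCondition T
    ∷ EndCondition T
    ∷ RightCoverInclusive T
    ∷ NECondition T
    ∷ StartCondition T
    ∷ LeftCoverInclusive T
    ∷ [] )
-- The translate condition is the hub: each condition implies it and follows from it.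
theorem3p1 lam mu _ T k l c = fromTranslate l (toTranslate k c)
  where
  conditions =
    CoverInclusive T
    ∷ DepthCondition T
    ∷ TranslateCondition T
    ∷ NWCondition T
    ∷ EndCondition T
    ∷ RightCoverInclusive T
    ∷ NECondition T
    ∷ StartCondition T
    ∷ LeftCoverInclusive T
    ∷ []

  tip⇒translate : ∀ s → TipCondition T s → TranslateCondition T
  tip⇒translate s h = up⇒translate T s (tip⇒up T s h)

  cover⇒translate : ∀ s → CoverInclusiveAt T s → TranslateCondition T
  cover⇒translate s h = tip⇒translate s (coverInclusive⇒tip T s h)

  toTranslate : ∀ k → lookup conditions k → TranslateCondition T
  toTranslate 0F (leftC , _) = cover⇒translate left leftC
  toTranslate 1F depth = up⇒translate T right (depth⇒up T right depth)
  toTranslate 2F translate = translate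
  toTranslate 3F = up⇒translate T left
  toTranslate 4F = tip⇒translate right
  toTranslate 5F = cover⇒translate right
  toTranslate 6F = up⇒translate T right
  toTranslate 7F = tip⇒translate left
  toTranslate 8F = cover⇒translate left

  fromTranslate : ∀ l → TranslateCondition T → lookup conditions l
  fromTranslate 0F h = translate⇒coverInclusive T h left , translate⇒coverInclusive T h right
  fromTranslate 1F h = translate⇒depth T h
  fromTranslate 2F h = h
  fromTranslate 3F h = depth⇒up T left (translate⇒depth T h)
  fromTranslate 4F h = coverInclusive⇒tip T right (translate⇒coverInclusive T h right)
  fromTranslate 5F h = translate⇒coverInclusive T h right
  fromTranslate 6F h = depth⇒up T right (translate⇒depth T h)
  fromTranslate 7F h = coverInclusive⇒tip T left (translate⇒coverInclusive T h left)
  fromTranslate 8F h = translate⇒coverInclusive T h left
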